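{- Let $n \ge 4$ be an even integer and let $T_{2n}(W)$ be the Toeplitz graph with vertex set $\{x_1,\dots,x_{2n}\}$ in which $x_i$ and $x_j$ are adjacent if and only if $|i-j|$ is odd or $|i-j| = n$. Then the $1$-domination number satisfies $\gamma_1(T_{2n}(W)) = 2$.
   Context: $T_{2n}(W)$ is defined from $W = \{x_1, x_3, \dots, x_{2n-1}\} \cup \{x_n\}$: distinct vertices $x_i, x_j$ ($1\le i,j\le 2n$) are adjacent iff $|i-j| = t$ for some $x_t \in W$, i.e. iff $|i-j|$ is odd or equals $n$. For a graph $G$ and an integer $k\ge 1$, a subset $D \subseteq V(G)$ is a $k$-dominating set if every vertex of $V(G)\setminus D$ has at least $k$ neighbors in $D$. The $k$-domination number $\gamma_k(G)$ is the minimum cardinality of a $k$-dominating set of $G$. -}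

module Defs where

open import Level using (0ℓ)
open import Data.Fin.Base using (Fin; toℕ)
import Data.Fin.Properties as Fin
open import Data.Fin.Subset using (Subset; _∉_; _∩_; ∣_∣)
open import Data.Nat.Base using (ℕ; suc; _*_; _≤_; ∣_-_∣)
open import Data.Nat.Divisibility using (_∣_; _∣?_)
open import Data.Nat.Properties using (_≟_; ∣-∣-comm)
open import Data.Product.Base using (_×_; _,_; ∃-syntax)
open import Data.Sum.Base using (_⊎_)
open import Data.Vec.Base using (tabulate)
open import Relation.Binary.Core using (Rel)
open import Relation.Binary.Definitions using (Symmetric; Decidable)
open import Relation.Binary.PropositionalEquality using (_≡_; _≢_; refl; sym; subst)
open import Relation.Nullary using (¬_; does; ¬?; _×-dec_; _⊎-dec_)
import Relation.Unary as U

-- Finite simple graphs with vertex set Fin m.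
record Graph (m : ℕ) : Set₁ where
  field
    Adj        : Rel (Fin m) 0ℓ
    adj?       : Decidable Adj
    adj-sym    : Symmetric Adj
    adj-irrefl : ∀ v → ¬ Adj v v

  neighbours : Fin m → Subset m
  neighbours v = tabulate λ u → does (adj? v u)

Dominating : ∀ {m} → ℕ → Graph m → Subset m → Set
Dominating k G D = ∀ v → v ∉ D → k ≤ ∣ Graph.neighbours G v ∩ D ∣

-- IsDominationNumber k G d says γₖ(G) = d: d is the minimum cardinality of a
-- k-dominating set.
IsDominationNumber : ∀ {m} → ℕ → Graph m → ℕ → Set
IsDominationNumber k G d =
  (∃[ D ] (Dominating k G D × ∣ D ∣ ≡ d)) ×
  (∀ D → Dominating k G D → d ≤ ∣ D ∣)

-- The vertices x₁, …, xₘ are numbered from 1, those of Fin m from 0.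
index : ∀ {m} → Fin m → ℕ
index v = suc (toℕ v)

-- The Toeplitz graph on x₁, …, xₘ of a decidable set W of distances. The
-- conjunct i ≢ j excludes loops when 0 belongs to W.
toeplitz : ∀ m {W : U.Pred ℕ 0ℓ} → U.Decidable W → Graph m
toeplitz m {W} W? = record
  { Adj        = λ i j → i ≢ j × W ∣ index i - index j ∣
  ; adj?       = λ i j → ¬? (i Fin.≟ j) ×-dec W? ∣ index i - index j ∣
  ; adj-sym    = λ {i} {j} (i≢j , w) →
      (λ j≡i → i≢j (sym j≡i)) , subst W (∣-∣-comm (index i) (index j)) w
  ; adj-irrefl = λ v (v≢v , _) → v≢v refl
  }

Even Odd : ℕ → Set
Even t = 2 ∣ t
Odd t = ¬ Even t

-- The set {1, 3, …, 2n-1} ∪ {n}. The bound 2n-1 on the odd members is left out: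
-- distances between vertices of a graph of order 2n never exceed it.
OddOr : ℕ → U.Pred ℕ 0ℓ
OddOr n t = Odd t ⊎ t ≡ n

oddOr? : ∀ n → U.Decidable (OddOr n)
oddOr? n t = ¬? (2 ∣? t) ⊎-dec (t ≟ n)

T₂ₙ[W] : ∀ n → Graph (2 * n)
T₂ₙ[W] n = toeplitz (2 * n) (oddOr? n)

{-# OPTIONS --safe #-}
module Submission where

open import Defs
open import Level using (0ℓ)
open import Data.Bool.Base using (true)
open import Data.Fin.Base using (Fin; zero; suc; inject₁; toℕ)
open import Data.Fin.Properties using (toℕ-inject₁)
open import Data.Fin.Subset using (Subset; Nonempty; _∈_; _∩_; inside; ⊥; ∣_∣)
open import Data.Fin.Subset.Properties
  using (_∈?_; nonempty?; Empty-unique; ∣⊥∣≡0; x∈p∩q⁺; x∈p∩q⁻; x∈p⇒∣p-x∣<∣p∣; x∈p∧x≢y⇒x∈p-y)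
open import Data.Nat.Base using (ℕ; suc; _+_; _≤_; z≤n; s≤s; ∣_-_∣)
open import Data.Nat.Divisibility using (_∣_; _∣?_; ∣-refl; ∣m+n∣m⇒∣n; ∣1⇒≡1)
open import Data.Nat.Properties using (≤-trans; m≤m+n; ∣m-m+n∣≡n; ∣n-n∣≡0; +-comm)
open import Data.Product.Base using (_×_; _,_; ∃-syntax; Σ-syntax)
open import Data.Sum.Base using (inj₁; inj₂)
open import Data.Vec.Base using (_∷_; here; there)
open import Data.Vec.Properties using (lookup⇒[]=; []=⇒lookup; lookup∘tabulate)
open import Relation.Binary.PropositionalEquality
  using (_≡_; _≢_; refl; sym; trans; cong; subst)
open import Relation.Nullary using (¬_; Dec; does; yes; no; contradiction)
open import Relation.Nullary.Decidable using (dec-true)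
import Relation.Unary as U

-- Vertices of different parity are adjacent, so {x₁, x₂} dominates. Conversely,
-- a dominating set contains some w, and there is a vertex v at distance 2 from w,
-- which is not adjacent to w because 2 is neither odd nor equal to n. Hence v, or
-- a neighbour of v, is a second element of the set.

does-true⁻ : {P : Set} (P? : Dec P) → does P? ≡ true → P
does-true⁻ (yes p) _ = p

1≤∣p∣⇒Nonempty : ∀ {m} (p : Subset m) → 1 ≤ ∣ p ∣ → Nonempty p
1≤∣p∣⇒Nonempty {m} p 1≤∣p∣ with nonempty? p
... | yes ne = ne
... | no  e  = contradiction
  (subst (1 ≤_) (trans (cong ∣_∣ (Empty-unique e)) (∣⊥∣≡0 m)) 1≤∣p∣) λ ()

x∈p⇒1≤∣p∣ : ∀ {m} {x : Fin m} {p : Subset m} → x ∈ p → 1 ≤ ∣ p ∣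
x∈p⇒1≤∣p∣ x∈p = ≤-trans (s≤s z≤n) (x∈p⇒∣p-x∣<∣p∣ x∈p)

-- Deleting `y` leaves `x` behind and strictly lowers the cardinality.
x≢y⇒2≤∣p∣ : ∀ {m} {x y : Fin m} {p : Subset m} → x ∈ p → y ∈ p → x ≢ y → 2 ≤ ∣ p ∣
x≢y⇒2≤∣p∣ x∈p y∈p x≢y =
  ≤-trans (s≤s (x∈p⇒1≤∣p∣ (x∈p∧x≢y⇒x∈p-y x∈p x≢y))) (x∈p⇒∣p-x∣<∣p∣ y∈p)

module _ {m} (G : Graph m) where
  open Graph G

  ∈-neighbours⁺ : ∀ {v u} → Adj v u → u ∈ neighbours v
  ∈-neighbours⁺ {v} {u} a =
    lookup⇒[]= u _ (trans (lookup∘tabulate _ u) (dec-true (adj? v u) a))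

  ∈-neighbours⁻ : ∀ {v u} → u ∈ neighbours v → Adj v u
  ∈-neighbours⁻ {v} {u} u∈ =
    does-true⁻ (adj? v u) (trans (sym (lookup∘tabulate _ u)) ([]=⇒lookup u∈))

  adj⇒dominated : ∀ {D} v {u} → Adj v u → u ∈ D → 1 ≤ ∣ neighbours v ∩ D ∣
  adj⇒dominated v a u∈D = x∈p⇒1≤∣p∣ (x∈p∩q⁺ (∈-neighbours⁺ a , u∈D))

  dominated⇒adj : ∀ {D v} → 1 ≤ ∣ neighbours v ∩ D ∣ → ∃[ u ] (Adj v u × u ∈ D)
  dominated⇒adj {D} {v} 1≤ with 1≤∣p∣⇒Nonempty (neighbours v ∩ D) 1≤
  ... | u , u∈ with x∈p∩q⁻ (neighbours v) D u∈
  ...   | u∈N , u∈D = u , ∈-neighbours⁻ u∈N , u∈D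

  -- The vertex `v` excludes the graph of order 0, which the empty set dominates. Either `v` itself
  -- lies in `D`, or some neighbour of it does.
  dominating⇒Nonempty : ∀ {D} → Dominating 1 G D → Fin m → Nonempty D
  dominating⇒Nonempty {D} dom v with v ∈? D
  ... | yes v∈D = v , v∈D
  ... | no  v∉D with dominated⇒adj (dom v v∉D)
  ...   | u , _ , u∈D = u , u∈D

  no-universal-vertex⇒2≤∣D∣ : Fin m → (∀ w → ∃[ v ] (v ≢ w × ¬ Adj v w)) →
                              ∀ D → Dominating 1 G D → 2 ≤ ∣ D ∣
  no-universal-vertex⇒2≤∣D∣ v₀ nonadj D dom with dominating⇒Nonempty dom v₀
  ... | w , w∈D with nonadj w
  ...   | v , v≢w , ¬vw with v ∈? D
  ...     | yes v∈D = x≢y⇒2≤∣p∣ v∈D w∈D v≢w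
  ...     | no  v∉D with dominated⇒adj (dom v v∉D)
  ...       | u , vu , u∈D = x≢y⇒2≤∣p∣ u∈D w∈D λ { refl → ¬vw vu }

-- Two consecutive even numbers would make 2 divide their difference 1.
even⇒odd-pred : ∀ {t} → Even (suc t) → Odd t
even⇒odd-pred {t} 2∣1+t 2∣t with ∣1⇒≡1 (∣m+n∣m⇒∣n (subst (2 ∣_) (+-comm 1 t) 2∣1+t) 2∣t)
... | ()

-- The first two vertices move up by two, all others move down by two. Four vertices suffice for
-- this, whereas with three the middle one has no partner.
vertex-at-distance-2 : ∀ {m} → 4 ≤ m → (w : Fin m) →
                       Σ[ v ∈ Fin m ] ∣ index v - index w ∣ ≡ 2
vertex-at-distance-2 (s≤s (s≤s (s≤s (s≤s _)))) zero          = suc (suc zero) , refl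
vertex-at-distance-2 (s≤s (s≤s (s≤s (s≤s _)))) (suc zero)    = suc (suc (suc zero)) , refl
vertex-at-distance-2 (s≤s (s≤s (s≤s (s≤s _)))) (suc (suc w)) =
  -- `inject₁` keeps the numerical value, so this vertex is numbered two below `suc (suc w)`.
  inject₁ (inject₁ w) , distance (trans (toℕ-inject₁ (inject₁ w)) (toℕ-inject₁ w))
  where
  -- The offset 1 in both values of `index` has cancelled by computation.
  distance : ∀ {a b} → a ≡ b → ∣ a - 2 + b ∣ ≡ 2
  distance {a} refl = trans (cong (∣ a -_∣) (+-comm 2 a)) (∣m-m+n∣≡n a 2)

module _ {W : U.Pred ℕ 0ℓ} (W? : U.Decidable W) where

  -- `Odd U.⊆ W` gives the upper bound, `¬ W 2` the lower one.
  γ₁-toeplitz≡2 : ∀ {m} → 4 ≤ m → Odd U.⊆ W → ¬ W 2 →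
                  IsDominationNumber 1 (toeplitz m W?) 2
  γ₁-toeplitz≡2 {suc (suc m)} 4≤m@(s≤s (s≤s _)) odd⊆W 2∉W =
    (D₀ , dominating , cong (2 +_) (∣⊥∣≡0 m)) ,
    no-universal-vertex⇒2≤∣D∣ G zero nonadjacent
    where
    G = toeplitz (2 + m) W?

    D₀ : Subset (2 + m)
    D₀ = inside ∷ inside ∷ ⊥

    dominating : Dominating 1 G D₀
    dominating zero          v∉D = contradiction here v∉D
    dominating (suc zero)    v∉D = contradiction (there here) v∉D
    -- The distances to x₁ and x₂ are `2 + toℕ v` and `1 + toℕ v`. One of them is odd, and the
    -- parity of the first decides which vertex dominates.
    dominating (suc (suc v)) _ with 2 ∣? 2 + toℕ v
    ... | yes even = adj⇒dominated G (suc (suc v)) {suc zero}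
                       ((λ ()) , odd⊆W (even⇒odd-pred even)) (there here)
    ... | no  odd  = adj⇒dominated G (suc (suc v)) {zero} ((λ ()) , odd⊆W odd) here

    nonadjacent : ∀ w → ∃[ v ] (v ≢ w × ¬ Graph.Adj G v w)
    nonadjacent w with vertex-at-distance-2 4≤m w
    ... | v , d≡2 = v , v≢w , λ (_ , d∈W) → 2∉W (subst W d≡2 d∈W)
      where
      v≢w : v ≢ w
      v≢w refl = contradiction (trans (sym d≡2) (∣n-n∣≡0 (index w))) λ ()

proposition3p14 : ∀ (n : ℕ) → 4 ≤ n → Even n → IsDominationNumber 1 (T₂ₙ[W] n) 2
proposition3p14 n 4≤n _ =
  -- `2 * n` unfolds to `n + (n + 0)`, so the order is at least `n`, hence at least 4.
  γ₁-toeplitz≡2 (oddOr? n) (≤-trans 4≤n (m≤m+n n _)) inj₁ (2∉OddOr 4≤n)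
  where
  2∉OddOr : ∀ {n} → 4 ≤ n → ¬ OddOr n 2
  2∉OddOr _              (inj₁ odd)  = odd ∣-refl
  2∉OddOr (s≤s (s≤s ())) (inj₂ refl)
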